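{- For all finite sets of formulas $\Gamma,\Delta$: if $\Gamma\Vdash\Delta$, then the sequent $\Gamma\Rightarrow\Delta$ is provable in $\mathsf{CLp}$.
   Context: Fix a countably infinite set $\mathsf{At}$ of atoms. Formulas are built from atoms and the constant $\bot$ using the binary connectives $\land,\lor,\to$. All contexts are finite sets (not multisets) of formulas; a comma denotes union; a subscript $\mathsf{At}$ indicates a finite set of atoms. An atomic sequent has the form $\Gamma_{\mathsf{At}} \Rightarrow \Delta_{\mathsf{At}}$. An atomic rule has finitely many (possibly zero) atomic sequents as premises and one atomic sequent as conclusion; a rule with zero premises is an atomic axiom. A base is a (possibly empty) set of atomic rules; $\mathcal{C}\supseteq\mathcal{B}$ ($\mathcal{C}$ extends $\mathcal{B}$) if $\mathcal{C}$ contains every rule of $\mathcal{B}$. Derivability $\vdash_{\mathcal{B}}$ of atomic sequents is the least relation such that: (Axiom/Weakening) if an atomic axiom with conclusion $\Gamma_{\mathsf{At}}\Rightarrow\Delta_{\mathsf{At}}$ is in $\mathcal{B}$, then $\vdash_{\mathcal{B}} \Theta_{\mathsf{At}},\Gamma_{\mathsf{At}}\Rightarrow\Delta_{\mathsf{At}},\Sigma_{\mathsf{At}}$ for all sets of atoms $\Theta_{\mathsf{At}},\Sigma_{\mathsf{At}}$; (Mix) if a rule with premises $\Gamma^i_{\mathsf{At}}\Rightarrow\Delta^i_{\mathsf{At}}$ ($1\le i\le n$) and conclusion $\Gamma_{\mathsf{At}}\Rightarrow\Delta_{\mathsf{At}}$ is in $\mathcal{B}$ and $\vdash_{\mathcal{B}}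 \Theta^i_{\mathsf{At}},\Gamma^i_{\mathsf{At}}\Rightarrow\Delta^i_{\mathsf{At}},\Sigma^i_{\mathsf{At}}$ for each $i$, then $\vdash_{\mathcal{B}} \Theta^1_{\mathsf{At}},\dots,\Theta^n_{\mathsf{At}},\Gamma_{\mathsf{At}}\Rightarrow\Delta_{\mathsf{At}},\Sigma^1_{\mathsf{At}},\dots,\Sigma^n_{\mathsf{At}}$. Support $\Vdash_{\mathcal{B}}$: (At) $\Vdash_{\mathcal{B}}\Gamma_{\mathsf{At}}$ iff $\vdash_{\mathcal{B}}\ \Rightarrow\Gamma_{\mathsf{At}}$; ($\land$) $\Vdash_{\mathcal{B}} A\land B,\Gamma$ iff $\Vdash_{\mathcal{B}}A,\Gamma$ and $\Vdash_{\mathcal{B}}B,\Gamma$; ($\lor$) $\Vdash_{\mathcal{B}}A\lor B,\Gamma$ iff $\Vdash_{\mathcal{B}}A,B,\Gamma$; ($\to$) $\Vdash_{\mathcal{B}}A\to B,\Gamma$ iff $A\Vdash_{\mathcal{B}}B,\Gamma$; ($\bot$) $\Vdash_{\mathcal{B}}\bot,\Gamma$ iff $\Vdash_{\mathcal{B}}\Gamma$; (Inf) for $n\ge1$, $\{A^1,\dots,A^n\}\Vdash_{\mathcal{B}}\Delta$ iff for every $\mathcal{C}\supseteq\mathcal{B}$ and all sets of atoms $\Theta^1_{\mathsf{At}},\dots,\Theta^n_{\mathsf{At}}$, if $\Vdash_{\mathcal{C}}\Theta^i_{\mathsf{At}},A^i$ for all $i$ then $\Vdash_{\mathcal{C}}\Theta^1_{\mathsf{At}},\dots,\Theta^n_{\mathsf{At}},\Delta$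 (and $\varnothing\Vdash_{\mathcal{B}}\Delta$ means $\Vdash_{\mathcal{B}}\Delta$). The atomic identity rule $\mathsf{Ainit}$ is the atomic axiom $\Gamma_{\mathsf{At}},p\Rightarrow p,\Delta_{\mathsf{At}}$; the atomic cut rule $\mathsf{Acut}$ has premises $\Gamma^1_{\mathsf{At}}\Rightarrow\Delta^1_{\mathsf{At}},p$ and $p,\Gamma^2_{\mathsf{At}}\Rightarrow\Delta^2_{\mathsf{At}}$ and conclusion $\Gamma^1_{\mathsf{At}},\Gamma^2_{\mathsf{At}}\Rightarrow\Delta^1_{\mathsf{At}},\Delta^2_{\mathsf{At}}$. $\mathcal{ST}$ is the base consisting of all instances of $\mathsf{Ainit}$ and $\mathsf{Acut}$. Validity: $\Gamma\Vdash\Delta$ iff $\Gamma\Vdash_{\mathcal{B}}\Delta$ for every base $\mathcal{B}\supseteq\mathcal{ST}$. $\mathsf{CLp}$ is the sequent calculus on sequents $\Gamma\Rightarrow\Delta$ (finite sets of formulas) with rules: $\mathsf{init}$: $\Gamma,A\Rightarrow A,\Delta$; $L\bot$: $\Gamma,\bot\Rightarrow\Delta$; $R\bot$: from $\Gamma\Rightarrow\Delta$ infer $\Gamma\Rightarrow\bot,\Delta$; $L\land$: from $A,B,\Gamma\Rightarrow\Delta$ infer $A\land B,\Gamma\Rightarrow\Delta$; $R\land$: from $\Gamma\Rightarrow\Delta,A$ and $\Gamma'\Rightarrow\Delta',B$ infer $\Gamma,\Gamma'\Rightarrow\Delta,\Delta',A\land B$; $L\lor$: from $A,\Gamma\Rightarrow\Delta$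 and $B,\Gamma'\Rightarrow\Delta'$ infer $A\lor B,\Gamma,\Gamma'\Rightarrow\Delta,\Delta'$; $R\lor$: from $\Gamma\Rightarrow\Delta,A,B$ infer $\Gamma\Rightarrow\Delta,A\lor B$; $L\to$: from $\Gamma\Rightarrow\Delta,A$ and $B,\Gamma'\Rightarrow\Delta'$ infer $A\to B,\Gamma,\Gamma'\Rightarrow\Delta,\Delta'$; $R\to$: from $A,\Gamma\Rightarrow\Delta,B$ infer $\Gamma\Rightarrow\Delta,A\to B$. -}

module Defs where

open import Data.Fin.Base using (Fin; zero; suc)
open import Data.List.Base using (List; []; _∷_; _++_; [_]; concat; foldr; length; lookup; map; tabulate)
open import Data.List.Membership.Propositional using (_∈_)
open import Data.List.Membership.Propositional.Properties using (∈-++⁺ˡ; ∈-++⁺ʳ; ∈-++⁻; ∈-concat⁺′; ∈-concat⁻′; ∈-tabulate⁺; ∈-tabulate⁻; ∈-lookup)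
open import Data.List.Relation.Binary.BagAndSetEquality using (_∼[_]_; set)
open import Data.List.Relation.Binary.Pointwise as Pointwise using (Pointwise)
open import Data.List.Relation.Binary.Subset.Propositional using (_⊆_)
open import Data.List.Relation.Unary.Any using (here; there; index)
open import Data.List.Relation.Unary.Any.Properties using (lookup-index)
open import Data.Product.Base using (_×_; _,_; proj₁; proj₂; ∃-syntax)
open import Data.Sum.Base using ([_,_]′)
open import Function.Base using (_∘_; id)
open import Function.Bundles using (_⇔_; mk⇔; Equivalence)
open import Relation.Binary.Core using (Rel)
open import Relation.Binary.Definitions using (_Respects_)
open import Relation.Binary.PropositionalEquality using (refl; sym; subst)

private
  variable
    At X : Set

infixr 8 _∧_
infixr 7 _∨_
infixr 6 _⊃_

data Formula (At : Set) : Set where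
  atom        : At → Formula At
  ⊥           : Formula At
  _∧_ _∨_ _⊃_ : Formula At → Formula At → Formula At

-- Finite sets are lists taken up to set equality: comma is _++_ (or _∷_ for a
-- single element), and everything below is closed under _≈_.

infix 4 _⇒_ _≈_

record Sequent (X : Set) : Set where
  constructor _⇒_
  field
    ante succ : List X

open Sequent public

_≈_ : Rel (Sequent X) _
s ≈ t = ante s ∼[ set ] ante t × succ s ∼[ set ] succ t

infix 3 _/_

record Rule (At : Set) : Set where
  constructor _/_
  field
    premises   : List (Sequent At)
    conclusion : Sequent At

open Rule public

infix 4 _≈ᴿ_

_≈ᴿ_ : Rel (Rule At) _
r ≈ᴿ r′ = Pointwise _≈_ (premises r) (premises r′) × conclusion r ≈ conclusion r′

record Base (At : Set) : Set₁ where
  field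
    rules    : Rule At → Set
    respects : rules Respects _≈ᴿ_

open Base public

infix 4 _⊑_

_⊑_ : Base At → Base At → Set
B ⊑ C = ∀ {r} → rules B r → rules C r

infix 3 _⊢_

data _⊢_ (B : Base At) : Sequent At → Set₁ where
  axiom : ∀ {Γ Δ} (Θ Σ : List At) →
          rules B ([] / Γ ⇒ Δ) →
          B ⊢ Θ ++ Γ ⇒ Δ ++ Σ
  mix   : ∀ {ps Γ Δ} (Θ Σ : Fin (length ps) → List At) →
          rules B (ps / Γ ⇒ Δ) →
          (∀ i → B ⊢ Θ i ++ ante (lookup ps i) ⇒ succ (lookup ps i) ++ Σ i) →
          B ⊢ concat (tabulate Θ) ++ Γ ⇒ Δ ++ concat (tabulate Σ)
  set≈  : ∀ {s t} → s ≈ t → B ⊢ s → B ⊢ t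

-- Support is defined by decomposing the leftmost formula of a list.  If K B Θ
-- stands for  ⊩_B Θ_At, Γ  then adjoin A K B Θ stands for  ⊩_B Θ_At, A, Γ.
-- That this yields the support clauses for arbitrary finite sets (so that the
-- order of decomposition and repetitions are immaterial) is proved in
-- SupportClauses.

Support : Set → Set₂
Support At = Base At → List At → Set₁

atomic : Support At
atomic B Θ = B ⊢ [] ⇒ Θ

adjoin : Formula At → Support At → Support At
adjoin (atom p) K B Θ = K B (p ∷ Θ)
adjoin ⊥        K B Θ = K B Θ
adjoin (A ∧ A′) K B Θ = adjoin A K B Θ × adjoin A′ K B Θ
adjoin (A ∨ A′) K B Θ = adjoin A (adjoin A′ K) B Θ
adjoin (A ⊃ A′) K B Θ = ∀ C → B ⊑ C → ∀ Ξ → adjoin A atomic C Ξ → adjoin A′ K C (Ξ ++ Θ)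

infix 3 ⊩[_]_ _⊩[_]_ _⊩_

⊩[_]_ : Base At → List (Formula At) → Set₁
⊩[ B ] Γ = foldr adjoin atomic Γ B []

_⊩[_]_ : List (Formula At) → Base At → List (Formula At) → Set₁
[]        ⊩[ B ] Δ = ⊩[ B ] Δ
Γ@(_ ∷ _) ⊩[ B ] Δ = ∀ C → B ⊑ C → (Θ : Fin (length Γ) → List _) →
                     (∀ i → ⊩[ C ] map atom (Θ i) ++ [ lookup Γ i ]) →
                     ⊩[ C ] map atom (concat (tabulate Θ)) ++ Δ

data STInstance {At : Set} : Rule At → Set where
  Ainit : ∀ Γ Δ p → STInstance ([] / p ∷ Γ ⇒ p ∷ Δ)
  Acut  : ∀ Γ¹ Δ¹ Γ² Δ² p →
          STInstance ((Γ¹ ⇒ p ∷ Δ¹) ∷ (p ∷ Γ² ⇒ Δ²) ∷ [] / Γ¹ ++ Γ² ⇒ Δ¹ ++ Δ²)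

≈-sym : {s t : Sequent X} → s ≈ t → t ≈ s
≈-sym (p , q) = flip p , flip q
  where
    flip : {xs ys : List X} → xs ∼[ set ] ys → ys ∼[ set ] xs
    flip p = mk⇔ (Equivalence.from p) (Equivalence.to p)

≈-trans : {s t u : Sequent X} → s ≈ t → t ≈ u → s ≈ u
≈-trans (p , q) (p′ , q′) = comp p p′ , comp q q′
  where
    comp : {xs ys zs : List X} → xs ∼[ set ] ys → ys ∼[ set ] zs → xs ∼[ set ] zs
    comp p q = mk⇔ (Equivalence.to q ∘ Equivalence.to p) (Equivalence.from p ∘ Equivalence.from q)

ST : Base At
rules    ST r = ∃[ r′ ] STInstance r′ × r′ ≈ᴿ r
respects ST (ps≈ , c≈) (r′ , inst , ps′≈ , c′≈) =
  r′ , inst , Pointwise.transitive ≈-trans ps′≈ ps≈ , ≈-trans c′≈ c≈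

_⊩_ : List (Formula At) → List (Formula At) → Set₁
Γ ⊩ Δ = ∀ B → ST ⊑ B → Γ ⊩[ B ] Δ

infix 3 CLp⊢_

data CLp⊢_ {At : Set} : Sequent (Formula At) → Set where
  init : ∀ {Γ Δ A} → CLp⊢ A ∷ Γ ⇒ A ∷ Δ
  L⊥   : ∀ {Γ Δ} → CLp⊢ ⊥ ∷ Γ ⇒ Δ
  R⊥   : ∀ {Γ Δ} → CLp⊢ Γ ⇒ Δ → CLp⊢ Γ ⇒ ⊥ ∷ Δ
  L∧   : ∀ {Γ Δ A B} → CLp⊢ A ∷ B ∷ Γ ⇒ Δ → CLp⊢ A ∧ B ∷ Γ ⇒ Δ
  R∧   : ∀ {Γ Γ′ Δ Δ′ A B} → CLp⊢ Γ ⇒ A ∷ Δ → CLp⊢ Γ′ ⇒ B ∷ Δ′ →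
         CLp⊢ Γ ++ Γ′ ⇒ A ∧ B ∷ Δ ++ Δ′
  L∨   : ∀ {Γ Γ′ Δ Δ′ A B} → CLp⊢ A ∷ Γ ⇒ Δ → CLp⊢ B ∷ Γ′ ⇒ Δ′ →
         CLp⊢ A ∨ B ∷ Γ ++ Γ′ ⇒ Δ ++ Δ′
  R∨   : ∀ {Γ Δ A B} → CLp⊢ Γ ⇒ A ∷ B ∷ Δ → CLp⊢ Γ ⇒ A ∨ B ∷ Δ
  L⊃   : ∀ {Γ Γ′ Δ Δ′ A B} → CLp⊢ Γ ⇒ A ∷ Δ → CLp⊢ B ∷ Γ′ ⇒ Δ′ →
         CLp⊢ A ⊃ B ∷ Γ ++ Γ′ ⇒ Δ ++ Δ′
  R⊃   : ∀ {Γ Δ A B} → CLp⊢ A ∷ Γ ⇒ B ∷ Δ → CLp⊢ Γ ⇒ A ⊃ B ∷ Δ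
  set≈ : ∀ {s t} → s ≈ t → CLp⊢ s → CLp⊢ t

module SupportClauses {At : Set} where

  private
    Upward : Support At → Set₁
    Upward K = ∀ {B C Θ Θ′} → B ⊑ C → Θ ⊆ Θ′ → K B Θ → K C Θ′

    absorbˡ : {xs ys : List X} → ys ⊆ xs → xs ++ ys ∼[ set ] xs
    absorbˡ {xs = xs} ys⊆ = mk⇔ (λ m → [ id , ys⊆ ]′ (∈-++⁻ xs m)) ∈-++⁺ˡ

    absorbʳ : {xs ys : List X} → xs ⊆ ys → xs ++ ys ∼[ set ] ys
    absorbʳ {xs = xs} xs⊆ = mk⇔ (λ m → [ xs⊆ , id ]′ (∈-++⁻ xs m)) (∈-++⁺ʳ xs)

    ++-lub : {xs ys zs : List X} → xs ⊆ zs → ys ⊆ zs → xs ++ ys ⊆ zs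
    ++-lub {xs = xs} f g m = [ f , g ]′ (∈-++⁻ xs m)

    concat-lub : ∀ {n} (f : Fin n → List X) {zs} → (∀ i → f i ⊆ zs) → concat (tabulate f) ⊆ zs
    concat-lub f sub m with ∈-concat⁻′ (tabulate f) m
    ... | _ , m₁ , m₂ with ∈-tabulate⁻ {f = f} m₂
    ... | i , refl = sub i m₁

    ⊆-concat : ∀ {n} (f : Fin n → List X) i → f i ⊆ concat (tabulate f)
    ⊆-concat f i m = ∈-concat⁺′ m (∈-tabulate⁺ {f = f} i)

  ⊢-mono : ∀ {B C : Base At} {s t} → B ⊑ C → ante s ⊆ ante t → succ s ⊆ succ t → B ⊢ s → C ⊢ t
  ⊢-mono {t = t} inc a c (axiom {Γ} Θ Σ r) =
    set≈ (absorbˡ (a ∘ ∈-++⁺ʳ Θ) , absorbʳ (c ∘ ∈-++⁺ˡ)) (axiom (ante t) (succ t) (inc r))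
  ⊢-mono {t = t} inc a c (mix {[]} Θ Σ r ds) =
    set≈ (absorbˡ a , absorbʳ (c ∘ ∈-++⁺ˡ)) (axiom (ante t) (succ t) (inc r))
  ⊢-mono {t = t} inc a c (mix {ps@(_ ∷ _)} {Γ} {Δ} Θ Σ r ds) =
    set≈ ( mk⇔ (++-lub (concat-lub Θ′ λ _ → id) (a ∘ ∈-++⁺ʳ (concat (tabulate Θ))))
               (∈-++⁺ˡ ∘ ⊆-concat Θ′ zero)
         , mk⇔ (++-lub {xs = Δ} (c ∘ ∈-++⁺ˡ) (concat-lub Σ′ λ _ → id))
               (∈-++⁺ʳ Δ ∘ ⊆-concat Σ′ zero))
      (mix Θ′ Σ′ (inc r) λ i → ⊢-mono inc
        (++-lub (∈-++⁺ˡ ∘ a ∘ ∈-++⁺ˡ ∘ ⊆-concat Θ i) (∈-++⁺ʳ (ante t)))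
        (++-lub ∈-++⁺ˡ (∈-++⁺ʳ (succ (lookup ps i)) ∘ c ∘ ∈-++⁺ʳ Δ ∘ ⊆-concat Σ i))
        (ds i))
    where
      Θ′ Σ′ : Fin (length ps) → List At
      Θ′ _ = ante t
      Σ′ _ = succ t
  ⊢-mono inc a c (set≈ (p , q) d) = ⊢-mono inc (a ∘ Equivalence.to p) (c ∘ Equivalence.to q) d

  private
    cons-mono : ∀ {x : X} {xs ys} → xs ⊆ ys → x ∷ xs ⊆ x ∷ ys
    cons-mono f (here e)  = here e
    cons-mono f (there m) = there (f m)

    exch : ∀ {x y : X} {xs} → x ∷ y ∷ xs ⊆ y ∷ x ∷ xs
    exch (here e)          = there (here e)
    exch (there (here e))  = here e
    exch (there (there m)) = there (there m)

    ++-mono : ∀ (zs : List X) {xs ys} → xs ⊆ ys → zs ++ xs ⊆ zs ++ ys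
    ++-mono zs f = ++-lub {xs = zs} ∈-++⁺ˡ (∈-++⁺ʳ zs ∘ f)

    middle : ∀ (xs : List X) {y ys} → xs ++ y ∷ ys ⊆ y ∷ xs ++ ys
    middle xs = ++-lub {xs = xs} (there ∘ ∈-++⁺ˡ) (cons-mono (∈-++⁺ʳ xs))

    middle⁻ : ∀ (xs : List X) {y ys} → y ∷ xs ++ ys ⊆ xs ++ y ∷ ys
    middle⁻ xs (here e)  = ∈-++⁺ʳ xs (here e)
    middle⁻ xs (there m) = ++-mono xs there m

    rotate : ∀ (xs ys : List X) {zs} → xs ++ ys ++ zs ⊆ ys ++ xs ++ zs
    rotate xs ys = ++-lub {xs = xs} (∈-++⁺ʳ ys ∘ ∈-++⁺ˡ) (++-mono ys (∈-++⁺ʳ xs))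

    atomic↑ : Upward atomic
    atomic↑ inc sub = ⊢-mono inc id sub

    adjoin↑ : ∀ A {K} → Upward K → Upward (adjoin A K)
    adjoin↑ (atom p) K↑ inc sub k = K↑ inc (cons-mono sub) k
    adjoin↑ ⊥        K↑ inc sub k = K↑ inc sub k
    adjoin↑ (A ∧ B)  K↑ inc sub (k , l) = adjoin↑ A K↑ inc sub k , adjoin↑ B K↑ inc sub l
    adjoin↑ (A ∨ B)  K↑ inc sub k = adjoin↑ A (adjoin↑ B K↑) inc sub k
    adjoin↑ (A ⊃ B)  K↑ inc sub k = λ C inc′ Ξ a →
      adjoin↑ B K↑ id (++-mono Ξ sub) (k C (inc′ ∘ inc) Ξ a)

    gmap : ∀ A {K L : Support At} {B Θ} →
           (∀ C → B ⊑ C → ∀ Θ′ → Θ ⊆ Θ′ → K C Θ′ → L C Θ′) →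
           adjoin A K B Θ → adjoin A L B Θ
    gmap (atom p) f k = f _ id _ there k
    gmap ⊥        f k = f _ id _ id k
    gmap (A ∧ B)  f (k , l) = gmap A f k , gmap B f l
    gmap (A ∨ B)  f k =
      gmap A (λ C inc Θ′ sub → gmap B λ D inc′ Θ″ sub′ → f D (inc′ ∘ inc) Θ″ (sub′ ∘ sub)) k
    gmap (A ⊃ B)  f k = λ C inc Ξ a →
      gmap B (λ D inc′ Θ′ sub → f D (inc′ ∘ inc) Θ′ (sub ∘ ∈-++⁺ʳ Ξ)) (k C inc Ξ a)

    gmap′ : ∀ A {K L : Support At} → (∀ {C Θ} → K C Θ → L C Θ) →
            ∀ {B Θ} → adjoin A K B Θ → adjoin A L B Θ
    gmap′ A f = gmap A λ _ _ _ _ → f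

    weaken : ∀ A {K} → Upward K → ∀ {B Θ} → K B Θ → adjoin A K B Θ
    weaken (atom p) K↑ k = K↑ id there k
    weaken ⊥        K↑ k = k
    weaken (A ∧ B)  K↑ k = weaken A K↑ k , weaken B K↑ k
    weaken (A ∨ B)  K↑ k = weaken A (adjoin↑ B K↑) (weaken B K↑ k)
    weaken (A ⊃ B)  K↑ k = λ C inc Ξ _ → weaken B K↑ (K↑ inc (∈-++⁺ʳ Ξ) k)

    both : ∀ A {K L : Support At} {B Θ} → adjoin A K B Θ → adjoin A L B Θ →
           adjoin A (λ C Ξ → K C Ξ × L C Ξ) B Θ
    both (atom p) k l = k , l
    both ⊥        k l = k , l
    both (A ∧ B)  (k , k′) (l , l′) = both A k l , both B k′ l′
    both (A ∨ B)  k l = gmap′ A (λ (x , y) → both B x y) (both A k l)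
    both (A ⊃ B)  k l = λ C inc Ξ a → both B (k C inc Ξ a) (l C inc Ξ a)

    intoAtom : ∀ A {p K} → Upward K → ∀ {B Θ} →
               adjoin A K B (p ∷ Θ) → adjoin A (adjoin (atom p) K) B Θ
    intoAtom (atom q) K↑ k = K↑ id exch k
    intoAtom ⊥        K↑ k = k
    intoAtom (A ∧ B)  K↑ (k , l) = intoAtom A K↑ k , intoAtom B K↑ l
    intoAtom (A ∨ B)  K↑ k = gmap′ A (intoAtom B K↑) (intoAtom A (adjoin↑ B K↑) k)
    intoAtom (A ⊃ B)  K↑ k = λ C inc Ξ a →
      intoAtom B K↑ (adjoin↑ B K↑ id (middle Ξ) (k C inc Ξ a))

    Imp : Support At → Support At → Support At
    Imp Q K B Θ = ∀ C → B ⊑ C → ∀ Ξ → Q C Ξ → K C (Ξ ++ Θ)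

    intoImp : ∀ A {Q K} → Upward K → ∀ {B Θ} →
              Imp Q (adjoin A K) B Θ → adjoin A (Imp Q K) B Θ
    intoImp (atom p) K↑ k = λ C inc Ξ q → K↑ id (middle⁻ Ξ) (k C inc Ξ q)
    intoImp ⊥        K↑ k = k
    intoImp (A ∧ B)  K↑ k =
      intoImp A K↑ (λ C inc Ξ q → proj₁ (k C inc Ξ q)) ,
      intoImp B K↑ (λ C inc Ξ q → proj₂ (k C inc Ξ q))
    intoImp (A ∨ B)  K↑ k = gmap′ A (intoImp B K↑) (intoImp A (adjoin↑ B K↑) k)
    intoImp (A ⊃ B)  K↑ k = λ C inc Ξ a → intoImp B K↑ λ D inc′ Ξ′ q →
      adjoin↑ B K↑ id (rotate Ξ Ξ′)
        (k D (inc′ ∘ inc) Ξ′ q D id Ξ (adjoin↑ A atomic↑ inc′ id a))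

    swap : ∀ A A′ {K} → Upward K → ∀ {B Θ} →
           adjoin A (adjoin A′ K) B Θ → adjoin A′ (adjoin A K) B Θ
    swap (atom p) A′ K↑ k = intoAtom A′ K↑ k
    swap ⊥        A′ K↑ k = k
    swap (A ∧ B)  A′ K↑ (k , l) = both A′ (swap A A′ K↑ k) (swap B A′ K↑ l)
    swap (A ∨ B)  A′ K↑ k = swap A A′ (adjoin↑ B K↑) (gmap′ A (swap B A′ K↑) k)
    swap (A ⊃ B)  A′ K↑ k =
      intoImp A′ (adjoin↑ B K↑) λ C inc Ξ a → swap B A′ K↑ (k C inc Ξ a)

    contract : ∀ A {K} → Upward K → ∀ {B Θ} → adjoin A (adjoin A K) B Θ → adjoin A K B Θ
    contract (atom p) K↑ k = K↑ id (λ { (here e) → here e ; (there m) → m }) k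
    contract ⊥        K↑ k = k
    contract (A ∧ B)  K↑ (k , l) =
      contract A K↑ (gmap′ A proj₁ k) , contract B K↑ (gmap′ B proj₂ l)
    contract (A ∨ B)  K↑ k =
      gmap′ A (contract B K↑)
        (contract A (adjoin↑ B (adjoin↑ B K↑)) (gmap′ A (swap B A (adjoin↑ B K↑)) k))
    contract (A ⊃ B)  K↑ k = λ C inc Ξ a → contract B K↑
      (gmap B (λ D inc′ Θ′ sub f →
                adjoin↑ B K↑ id (++-lub (sub ∘ ∈-++⁺ˡ) id)
                  (f D id Ξ (adjoin↑ A atomic↑ inc′ id a)))
              (k C inc Ξ a))

    adjoins : List (Formula At) → Support At → Support At
    adjoins Γ K = foldr adjoin K Γ

    adjoins↑ : ∀ Γ {K} → Upward K → Upward (adjoins Γ K)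
    adjoins↑ []      K↑ = K↑
    adjoins↑ (A ∷ Γ) K↑ = adjoin↑ A (adjoins↑ Γ K↑)

    absorb : ∀ {A Γ} → A ∈ Γ → ∀ {B Θ} →
             adjoin A (adjoins Γ atomic) B Θ → adjoins Γ atomic B Θ
    absorb {A} {_ ∷ Γ} (here refl) = contract A (adjoins↑ Γ atomic↑)
    absorb {A} {A′ ∷ Γ} (there m) k = gmap′ A′ (absorb m) (swap A A′ (adjoins↑ Γ atomic↑) k)

    adjoins-⊆ : ∀ {Γ Δ} → Γ ⊆ Δ → ∀ {B Θ} → adjoins Γ atomic B Θ → adjoins Δ atomic B Θ
    adjoins-⊆ {Γ} {Δ} sub = absorbs Γ sub ∘ lift Γ (weakens Δ)
      where
        weakens : ∀ Δ {B Θ} → atomic B Θ → adjoins Δ atomic B Θ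
        weakens []      k = k
        weakens (A ∷ Δ) k = weaken A (adjoins↑ Δ atomic↑) (weakens Δ k)
        lift : ∀ Γ {K L : Support At} → (∀ {C Θ} → K C Θ → L C Θ) →
               ∀ {B Θ} → adjoins Γ K B Θ → adjoins Γ L B Θ
        lift []      f = f
        lift (A ∷ Γ) f = gmap′ A (lift Γ f)
        absorbs : ∀ Γ → Γ ⊆ Δ → ∀ {B Θ} → adjoins Γ (adjoins Δ atomic) B Θ → adjoins Δ atomic B Θ
        absorbs []      sub k = k
        absorbs (A ∷ Γ) sub k = absorb (sub (here refl)) (gmap′ A (absorbs Γ (sub ∘ there)) k)

    atoms⁻ : ∀ Θ Δ {B Ξ} → adjoins (map atom Θ ++ Δ) atomic B Ξ → adjoins Δ atomic B (Θ ++ Ξ)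
    atoms⁻ []      Δ k = k
    atoms⁻ (p ∷ Θ) Δ k = adjoins↑ Δ atomic↑ id (middle Θ) (atoms⁻ Θ Δ k)

    atoms⁺ : ∀ Θ Δ {B Ξ} → adjoins Δ atomic B (Θ ++ Ξ) → adjoins (map atom Θ ++ Δ) atomic B Ξ
    atoms⁺ []      Δ k = k
    atoms⁺ (p ∷ Θ) Δ k = atoms⁺ Θ Δ (adjoins↑ Δ atomic↑ id (middle⁻ Θ) k)

    unit⁺ : {xs : List X} → xs ⊆ xs ++ []
    unit⁺ = ∈-++⁺ˡ

    unit⁻ : {xs : List X} → xs ++ [] ⊆ xs
    unit⁻ = ++-lub id λ ()

  ⊩-mono : ∀ {B C : Base At} {Γ Δ} → B ⊑ C → Γ ⊆ Δ → ⊩[ B ] Γ → ⊩[ C ] Δ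
  ⊩-mono {Δ = Δ} inc sub k = adjoins↑ Δ atomic↑ inc id (adjoins-⊆ sub k)

  ⊩-set : ∀ {B : Base At} {Γ Δ} → Γ ∼[ set ] Δ → (⊩[ B ] Γ) ⇔ (⊩[ B ] Δ)
  ⊩-set eq = mk⇔ (⊩-mono id (Equivalence.to eq)) (⊩-mono id (Equivalence.from eq))

  ⊩-At : ∀ {B : Base At} Θ → (⊩[ B ] map atom Θ) ⇔ (B ⊢ [] ⇒ Θ)
  ⊩-At {B} Θ = mk⇔
    (λ k → atomic↑ {B} id unit⁻ (atoms⁻ Θ [] {B} (⊩-mono {B} {Γ = map atom Θ} id unit⁺ k)))
    (λ d → ⊩-mono {B} {Δ = map atom Θ} id unit⁻ (atoms⁺ Θ [] {B} (atomic↑ {B} id unit⁺ d)))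

  ⊩-∧ : ∀ {B : Base At} {A A′ Γ} → (⊩[ B ] A ∧ A′ ∷ Γ) ⇔ ((⊩[ B ] A ∷ Γ) × (⊩[ B ] A′ ∷ Γ))
  ⊩-∧ = mk⇔ id id

  ⊩-∨ : ∀ {B : Base At} {A A′ Γ} → (⊩[ B ] A ∨ A′ ∷ Γ) ⇔ (⊩[ B ] A ∷ A′ ∷ Γ)
  ⊩-∨ = mk⇔ id id

  ⊩-⊥ : ∀ {B : Base At} {Γ} → (⊩[ B ] ⊥ ∷ Γ) ⇔ (⊩[ B ] Γ)
  ⊩-⊥ = mk⇔ id id

  ⊩-⊃ : ∀ {B : Base At} {A A′ Γ} → (⊩[ B ] A ⊃ A′ ∷ Γ) ⇔ ([ A ] ⊩[ B ] A′ ∷ Γ)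
  ⊩-⊃ {B} {A} {A′} {Γ} = mk⇔
    (λ k C inc Θ a → atoms⁺ (concat (tabulate Θ)) (A′ ∷ Γ)
      (adjoins↑ (A′ ∷ Γ) atomic↑ id (++-lub {xs = Θ zero} (∈-++⁺ˡ ∘ ∈-++⁺ˡ) λ ())
        (k C inc (Θ zero) (adjoin↑ A atomic↑ id unit⁻ (atoms⁻ (Θ zero) [ A ] (a zero))))))
    (λ k C inc Ξ a → adjoins↑ (A′ ∷ Γ) atomic↑ id (++-lub id λ ())
      (atoms⁻ (Ξ ++ []) (A′ ∷ Γ)
        (k C inc (λ _ → Ξ) λ { zero → atoms⁺ Ξ [ A ] (adjoin↑ A atomic↑ id unit⁺ a) })))

  Inf-⊆ : ∀ {B : Base At} {Γ Γ′ Δ} → Γ ⊆ Γ′ → Γ ⊩[ B ] Δ → Γ′ ⊩[ B ] Δ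
  Inf-⊆ {Γ = []}    {[]}     sub k = k
  Inf-⊆ {Γ = []}    {_ ∷ _}  {Δ} sub k C inc Θ a =
    ⊩-mono inc (∈-++⁺ʳ (map atom (concat (tabulate Θ)))) k
  Inf-⊆ {Γ = _ ∷ _} {[]}     sub k with () ← sub (here refl)
  Inf-⊆ {Γ = Γ@(_ ∷ _)} {Γ′@(_ ∷ _)} {Δ} sub k C inc Θ a =
    atoms⁺ (concat (tabulate Θ)) Δ
      (adjoins↑ Δ atomic↑ id (++-lub (∈-++⁺ˡ ∘ concat-lub (Θ ∘ pos) λ i → ⊆-concat Θ (pos i)) λ ())
        (atoms⁻ (concat (tabulate (Θ ∘ pos))) Δ
          (k C inc (Θ ∘ pos) λ i →
            subst (λ A → ⊩[ C ] map atom (Θ (pos i)) ++ [ A ])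
                  (sym (lookup-index (mem i))) (a (pos i)))))
    where
      mem : ∀ i → lookup Γ i ∈ Γ′
      mem i = sub (∈-lookup i)
      pos : Fin (length Γ) → Fin (length Γ′)
      pos i = index (mem i)

  Inf-set : ∀ {B : Base At} {Γ Γ′ Δ Δ′} → Γ ∼[ set ] Γ′ → Δ ∼[ set ] Δ′ →
            Γ ⊩[ B ] Δ → Γ′ ⊩[ B ] Δ′
  Inf-set {Γ = Γ} {Δ = Δ} {Δ′} eq eq′ = Inf-⊆ (Equivalence.to eq) ∘ right Γ
    where
      right : ∀ {B : Base At} Γ → Γ ⊩[ B ] Δ → Γ ⊩[ B ] Δ′
      right []      k = ⊩-mono id (Equivalence.to eq′) k
      right (_ ∷ _) k C inc Θ a =
        ⊩-mono id (++-mono (map atom (concat (tabulate Θ))) (Equivalence.to eq′)) (k C inc Θ a)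

{-# OPTIONS --safe #-}

-- Root-first proof search in CLp either proves Γ ⇒ Δ or produces a two-valued
-- valuation refuting it.  Given such a valuation v, let B be the base of all
-- atomic rules that preserve truth under v; it contains ST.  Over any C ⊇ B,
-- a formula true under v is supported together with any context, and a formula
-- false under v can be deleted from any supported set, because B contains the
-- rules ⇒ p for v p true and from ⇒ p, Θ infer ⇒ Θ for v p false.  Hence
-- Γ ⊩ Δ would make the empty sequent derivable in B, which is impossible as B
-- preserves truth.

module Submission where

open import Defs
open import Data.Bool.Base using (Bool; true; false)
import Data.Empty as Empty
open import Data.Fin.Base using (zero)
open import Data.List.Base using (List; []; _∷_; _++_; concat; foldr; length; lookup; map; tabulate)
open import Data.List.Membership.Propositional using (_∈_; find)
open import Data.List.Membership.Propositional.Properties using (∈-++⁺ˡ; ∈-++⁺ʳ; ∈-++⁻; ∈-map⁺; ∈-lookup)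
import Data.List.Membership.DecPropositional as DecMembership
open import Data.List.Properties using (++-identityʳ)
open import Data.List.Relation.Binary.BagAndSetEquality using (_∼[_]_; set; bag-=⇒; ∷-cong; ↭⇒∼bag)
open import Data.List.Relation.Binary.Permutation.Propositional.Properties using (shift)
open import Data.List.Relation.Binary.Pointwise using (symmetric; All-resp-Pointwise)
open import Data.List.Relation.Binary.Subset.Propositional.Properties using (All-resp-⊇)
open import Data.List.Relation.Unary.All as All using (All; []; _∷_)
open import Data.List.Relation.Unary.All.Properties using (++⁺; ++⁻; ++⁻ˡ; ++⁻ʳ; map⁺; concat⁻; tabulate⁻; ¬Any⇒All¬)
open import Data.List.Relation.Unary.Any using (here; there; any?; index)
open import Data.List.Relation.Unary.Any.Properties using (lookup-index)
open import Data.Nat.Base using (ℕ; zero; suc)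
open import Data.Nat.Properties using () renaming (_≟_ to _≟ℕ_)
open import Data.Product.Base using (_×_; _,_; ∃-syntax)
open import Data.Sum.Base using (_⊎_; inj₁; inj₂; [_,_]′)
open import Data.Unit.Base using (⊤)
open import Function.Base using (_∘_; id)
open import Function.Bundles using (_↔_; mk⇔; Equivalence)
open import Function.Properties.Inverse using (↔⇒↣)
open import Relation.Binary.Definitions using (DecidableEquality; _Respects_)
open import Relation.Binary.PropositionalEquality using (_≡_; refl; sym; trans; subst; subst₂)
open import Relation.Nullary using (¬_; contradiction; does; yes; no)
open import Relation.Nullary.Decidable using (via-injection; dec-true; dec-false)

private
  variable
    At X : Set

-- Two-valued truth and falsity.

Valuation : Set → Set
Valuation At = At → Bool

infix 4 _⊨⁺_ _⊨⁻_

-- Falsity is defined positively rather than as a negation, so that a false conjunction names a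
-- false conjunct and a true implication names its cause.
mutual
  _⊨⁺_ : Valuation At → Formula At → Set
  v ⊨⁺ atom p = v p ≡ true
  v ⊨⁺ ⊥      = Empty.⊥
  v ⊨⁺ A ∧ B  = v ⊨⁺ A × v ⊨⁺ B
  v ⊨⁺ A ∨ B  = v ⊨⁺ A ⊎ v ⊨⁺ B
  v ⊨⁺ A ⊃ B  = v ⊨⁻ A ⊎ v ⊨⁺ B

  _⊨⁻_ : Valuation At → Formula At → Set
  v ⊨⁻ atom p = v p ≡ false
  v ⊨⁻ ⊥      = ⊤
  v ⊨⁻ A ∧ B  = v ⊨⁻ A ⊎ v ⊨⁻ B
  v ⊨⁻ A ∨ B  = v ⊨⁻ A × v ⊨⁻ B
  v ⊨⁻ A ⊃ B  = v ⊨⁺ A × v ⊨⁻ B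

Refutes : Valuation At → Sequent (Formula At) → Set
Refutes v s = All (v ⊨⁺_) (ante s) × All (v ⊨⁻_) (succ s)

-- Root-first proof search.

++-idem-set : {xs : List X} → xs ++ xs ∼[ set ] xs
++-idem-set {xs = xs} = mk⇔ (λ m → [ id , id ]′ (∈-++⁻ xs m)) ∈-++⁺ˡ

∷-++-idem-set : {x : X} {xs : List X} → x ∷ xs ++ xs ∼[ set ] x ∷ xs
∷-++-idem-set = ∷-cong refl ++-idem-set

∈⇒∷-set : {x : X} {xs : List X} → x ∈ xs → x ∷ xs ∼[ set ] xs
∈⇒∷-set m = mk⇔ (λ { (here refl) → m ; (there m′) → m′ }) there

shift-set : ∀ (xs : List X) {y ys} → xs ++ y ∷ ys ∼[ set ] y ∷ xs ++ ys
shift-set xs {y} {ys} = bag-=⇒ (↭⇒∼bag (shift y xs ys))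

Decided : Sequent (Formula At) → Set
Decided s = CLp⊢ s ⊎ ∃[ v ] Refutes v s

Decided-map : {s t : Sequent (Formula At)} →
              (CLp⊢ s → CLp⊢ t) → (∀ {v} → Refutes v s → Refutes v t) → Decided s → Decided t
Decided-map f g (inj₁ d)       = inj₁ (f d)
Decided-map f g (inj₂ (v , r)) = inj₂ (v , g r)

Decided-map₂ : {s s′ t : Sequent (Formula At)} → (CLp⊢ s → CLp⊢ s′ → CLp⊢ t) →
               (∀ {v} → Refutes v s → Refutes v t) → (∀ {v} → Refutes v s′ → Refutes v t) →
               Decided s → Decided s′ → Decided t
Decided-map₂ f g h (inj₂ (v , r)) _              = inj₂ (v , g r)
Decided-map₂ f g h (inj₁ d)       (inj₁ d′)      = inj₁ (f d d′)
Decided-map₂ f g h (inj₁ d)       (inj₂ (v , r)) = inj₂ (v , h r)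

Decided-≈ : {s t : Sequent (Formula At)} → s ≈ t → Decided s → Decided t
Decided-≈ s≈t@(p , q) = Decided-map (set≈ s≈t)
  λ (r , r′) → All-resp-⊇ (Equivalence.from p) r , All-resp-⊇ (Equivalence.from q) r′

-- Quantifying over the atomic part makes the search structural in the formulas.
Decidedᴬ : Sequent (Formula At) → Set
Decidedᴬ (Γ ⇒ Δ) = ∀ P Q → Decided (Γ ++ map atom P ⇒ Δ ++ map atom Q)

-- Both premises of a branching rule receive the full context, and the duplicates in the conclusion
-- merge by set equality. Hence a refutation of either premise also refutes the conclusion. Atoms
-- are moved into the atomic part.
mutual
  decideˡ : ∀ (A : Formula At) {Γ Δ} → Decidedᴬ (Γ ⇒ Δ) → Decidedᴬ (A ∷ Γ ⇒ Δ)
  decideˡ (atom p) {Γ} k P Q = Decided-≈ (shift-set Γ , mk⇔ id id) (k (p ∷ P) Q)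
  decideˡ ⊥        k P Q = inj₁ L⊥
  decideˡ (A ∧ B)  k P Q =
    Decided-map L∧ (λ { (a ∷ b ∷ r , r′) → (a , b) ∷ r , r′ }) (decideˡ A (decideˡ B k) P Q)
  decideˡ (A ∨ B)  k P Q = Decided-map₂
    (λ d d′ → set≈ (∷-++-idem-set , ++-idem-set) (L∨ d d′))
    (λ { (a ∷ r , r′) → inj₁ a ∷ r , r′ })
    (λ { (b ∷ r , r′) → inj₂ b ∷ r , r′ })
    (decideˡ A k P Q) (decideˡ B k P Q)
  decideˡ (A ⊃ B)  k P Q = Decided-map₂
    (λ d d′ → set≈ (∷-++-idem-set , ++-idem-set) (L⊃ d d′))
    (λ { (r , a ∷ r′) → inj₁ a ∷ r , r′ })
    (λ { (b ∷ r , r′) → inj₂ b ∷ r , r′ })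
    (decideʳ A k P Q) (decideˡ B k P Q)

  decideʳ : ∀ (A : Formula At) {Γ Δ} → Decidedᴬ (Γ ⇒ Δ) → Decidedᴬ (Γ ⇒ A ∷ Δ)
  decideʳ (atom p) {Δ = Δ} k P Q = Decided-≈ (mk⇔ id id , shift-set Δ) (k P (p ∷ Q))
  decideʳ ⊥        k P Q = Decided-map R⊥ (λ (r , r′) → r , _ ∷ r′) (k P Q)
  decideʳ (A ∧ B)  k P Q = Decided-map₂
    (λ d d′ → set≈ (++-idem-set , ∷-++-idem-set) (R∧ d d′))
    (λ { (r , a ∷ r′) → r , inj₁ a ∷ r′ })
    (λ { (r , b ∷ r′) → r , inj₂ b ∷ r′ })
    (decideʳ A k P Q) (decideʳ B k P Q)
  decideʳ (A ∨ B)  k P Q =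
    Decided-map R∨ (λ { (r , a ∷ b ∷ r′) → r , (a , b) ∷ r′ }) (decideʳ A (decideʳ B k) P Q)
  decideʳ (A ⊃ B)  k P Q =
    Decided-map R⊃ (λ { (a ∷ r , b ∷ r′) → r , (a , b) ∷ r′ }) (decideˡ A (decideʳ B k) P Q)

module _ (_≟_ : DecidableEquality At) where

  open DecMembership _≟_ using (_∈?_)

  decide-atomic : Decidedᴬ {At} ([] ⇒ [])
  decide-atomic P Q with any? (_∈? P) Q
  ... | yes shared = let p , p∈Q , p∈P = find shared in
    inj₁ (set≈ (∈⇒∷-set (∈-map⁺ atom p∈P) , ∈⇒∷-set (∈-map⁺ atom p∈Q)) init)
  -- The valuation makes exactly the atoms of `P` true; since no atom of `Q` lies in `P`, all of `Q`
  -- is false.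
  ... | no disjoint = inj₂ ((λ p → does (p ∈? P)) ,
    map⁺ (All.tabulate λ {p} → dec-true (p ∈? P)) ,
    map⁺ (All.map (λ {p} → dec-false (p ∈? P)) (¬Any⇒All¬ Q disjoint)))

  decide : ∀ Γ Δ → Decided {At} (Γ ⇒ Δ)
  decide Γ Δ = subst₂ (λ Γ Δ → Decided (Γ ⇒ Δ)) (++-identityʳ Γ) (++-identityʳ Δ) (go Γ Δ [] [])
    where
      go : ∀ Γ Δ → Decidedᴬ (Γ ⇒ Δ)
      go []      []      = decide-atomic
      go []      (A ∷ Δ) = decideʳ A (go [] Δ)
      go (A ∷ Γ) Δ       = decideˡ A (go Γ Δ)

-- The base of truth-preserving atomic rules.

module _ (v : Valuation At) where

  -- Stated negatively, so that the Mix case of soundness needs no search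
  -- through the side contexts for a true atom.
  Sat : Sequent At → Set
  Sat s = All (λ p → v p ≡ true) (ante s) → ¬ All (λ p → v p ≡ false) (succ s)

  Sat-resp-≈ : Sat Respects _≈_
  Sat-resp-≈ (p , q) sat as ss =
    sat (All-resp-⊇ (Equivalence.to p) as) (All-resp-⊇ (Equivalence.to q) ss)

  Preserving : Base At
  rules    Preserving r = All Sat (premises r) → Sat (conclusion r)
  respects Preserving (ps≈ , c≈) pres =
    Sat-resp-≈ c≈ ∘ pres ∘ All-resp-Pointwise Sat-resp-≈ (symmetric ≈-sym ps≈)

  STInstance-preserving : ∀ {r} → STInstance r → rules Preserving r
  STInstance-preserving (Ainit _ _ _) [] (t ∷ _) (f ∷ _) with () ← trans (sym t) f
  STInstance-preserving (Acut Γ¹ Δ¹ _ _ p) (sat₁ ∷ sat₂ ∷ []) as ss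
    -- The truth value of the cut atom selects the premise that is contradicted.
    with ++⁻ Γ¹ as | ++⁻ Δ¹ ss | v p in vp
  ... | as₁ , as₂ | ss₁ , ss₂ | true  = sat₂ (vp ∷ as₂) ss₂
  ... | as₁ , as₂ | ss₁ , ss₂ | false = sat₁ as₁ (vp ∷ ss₁)

  ST⊑Preserving : ST ⊑ Preserving
  ST⊑Preserving (_ , inst , r≈) = respects Preserving r≈ (STInstance-preserving inst)

  ⊢-sound : ∀ {s} → Preserving ⊢ s → Sat s
  ⊢-sound (axiom {Δ = Δ} Θ Σ r) as ss = r [] (++⁻ʳ Θ as) (++⁻ˡ Δ ss)
  ⊢-sound (mix {ps} {Δ = Δ} Θ Σ r ds) as ss =
    r (All.tabulate λ m → subst Sat (sym (lookup-index m)) (premise (index m)))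
      (++⁻ʳ (concat (tabulate Θ)) as) (++⁻ˡ Δ ss)
    where
      -- The assumptions already make every `Θ i` true and every `Σ i` false, so the side contexts
      -- drop out of the induction hypothesis.
      premise : ∀ i → Sat (lookup ps i)
      premise i as′ ss′ = ⊢-sound (ds i)
        (++⁺ (tabulate⁻ (concat⁻ (++⁻ˡ (concat (tabulate Θ)) as)) i) as′)
        (++⁺ ss′ (tabulate⁻ (concat⁻ (++⁻ʳ Δ ss)) i))
  ⊢-sound (set≈ s≈t d) = Sat-resp-≈ s≈t (⊢-sound d)

  -- Derivability and support over extensions of `Preserving`.

  open SupportClauses {At} using (⊢-mono)

  true-atom-⊢ : ∀ {C p Θ} → Preserving ⊑ C → v p ≡ true → atomic C (p ∷ Θ)
  true-atom-⊢ {p = p} {Θ} inc t =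
    axiom [] Θ (inc {[] / [] ⇒ p ∷ []} λ { _ _ (f ∷ []) → contradiction (trans (sym t) f) λ () })

  false-atom-⊢ : ∀ {C p Θ} → Preserving ⊑ C → v p ≡ false → atomic C (p ∷ Θ) → atomic C Θ
  false-atom-⊢ {C} {p} {Θ} inc f d =
    ⊢-mono {B = C} id id (λ m → [ id , (λ ()) ]′ (∈-++⁻ Θ m))
      (mix {ps = ([] ⇒ p ∷ Θ) ∷ []} (λ _ → []) (λ _ → [])
        (inc λ { (sat ∷ []) as ss → sat [] (f ∷ ss) })
        λ { zero → ⊢-mono id id ∈-++⁺ˡ d })

  -- `adjoin` carries the remaining formulas as a predicate `K`, so induction on the leading formula
  -- needs hypotheses on `K`. The predicate `atomic` meets the last two by the identity.
  Everywhere FromAtomic ToAtomic : Support At → Set₁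
  Everywhere K = ∀ {C Θ} → Preserving ⊑ C → K C Θ
  FromAtomic K = ∀ {C Θ} → Preserving ⊑ C → atomic C Θ → K C Θ
  ToAtomic   K = ∀ {C Θ} → Preserving ⊑ C → K C Θ → atomic C Θ

  adjoin-everywhere : ∀ A {K} → Everywhere K → Everywhere (adjoin A K)
  adjoin-everywhere (atom p) k inc = k inc
  adjoin-everywhere ⊥        k inc = k inc
  adjoin-everywhere (A ∧ B)  k inc = adjoin-everywhere A k inc , adjoin-everywhere B k inc
  adjoin-everywhere (A ∨ B)  k inc = adjoin-everywhere A (adjoin-everywhere B k) inc
  adjoin-everywhere (A ⊃ B)  k inc C inc′ Ξ _ = adjoin-everywhere B k (inc′ ∘ inc)

  adjoin-fromAtomic : ∀ A {K} → FromAtomic K → FromAtomic (adjoin A K)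
  adjoin-fromAtomic (atom p) k inc d = k inc (⊢-mono id id there d)
  adjoin-fromAtomic ⊥        k inc d = k inc d
  adjoin-fromAtomic (A ∧ B)  k inc d = adjoin-fromAtomic A k inc d , adjoin-fromAtomic B k inc d
  adjoin-fromAtomic (A ∨ B)  k inc d = adjoin-fromAtomic A (adjoin-fromAtomic B k) inc d
  adjoin-fromAtomic (A ⊃ B)  k inc d C inc′ Ξ _ =
    adjoin-fromAtomic B k (inc′ ∘ inc) (⊢-mono inc′ id (∈-++⁺ʳ Ξ) d)

  -- Implication forces the mutual recursion: a false antecedent has to be deleted, a true one
  -- supplied.
  mutual
    adjoin-true : ∀ A {K} → v ⊨⁺ A → FromAtomic K → Everywhere (adjoin A K)
    adjoin-true (atom p) t        k inc = k inc (true-atom-⊢ inc t)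
    adjoin-true (A ∧ B)  (a , b)  k inc = adjoin-true A a k inc , adjoin-true B b k inc
    adjoin-true (A ∨ B)  (inj₁ a) k inc = adjoin-true A a (adjoin-fromAtomic B k) inc
    adjoin-true (A ∨ B)  (inj₂ b) k inc = adjoin-everywhere A (adjoin-true B b k) inc
    -- Deleting the false antecedent leaves `Ξ` derivable, and weakening carries this on to the
    -- consequent.
    adjoin-true (A ⊃ B)  (inj₁ a) k inc C inc′ Ξ s =
      adjoin-fromAtomic B k (inc′ ∘ inc)
        (⊢-mono id id ∈-++⁺ˡ (adjoin-false A a (λ _ → id) (inc′ ∘ inc) s))
    adjoin-true (A ⊃ B)  (inj₂ b) k inc C inc′ Ξ _ = adjoin-true B b k (inc′ ∘ inc)

    adjoin-false : ∀ A {K} → v ⊨⁻ A → ToAtomic K → ToAtomic (adjoin A K)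
    adjoin-false (atom p) f        k inc s       = false-atom-⊢ inc f (k inc s)
    adjoin-false ⊥        _        k inc s       = k inc s
    adjoin-false (A ∧ B)  (inj₁ a) k inc (s , _) = adjoin-false A a k inc s
    adjoin-false (A ∧ B)  (inj₂ b) k inc (_ , s) = adjoin-false B b k inc s
    adjoin-false (A ∨ B)  (a , b)  k inc s       = adjoin-false A a (adjoin-false B b k) inc s
    adjoin-false (A ⊃ B)  (a , b)  k inc s       =
      -- The true antecedent is supported over the same base with no side atoms, which releases the
      -- consequent.
      adjoin-false B b k inc (s _ id [] (adjoin-true A a (λ _ → id) inc))

  false-toAtomic : ∀ {Δ} → All (v ⊨⁻_) Δ → ToAtomic (foldr adjoin atomic Δ)
  false-toAtomic []               _   = id
  false-toAtomic {A ∷ _} (f ∷ fs) inc = adjoin-false A f (false-toAtomic fs) inc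

  true-discharge : ∀ Γ {Δ} → All (v ⊨⁺_) Γ → Γ ⊩[ Preserving ] Δ → ⊩[ Preserving ] Δ
  true-discharge []            _  s = s
  true-discharge Γ@(_ ∷ _) {Δ} ts s =
    -- With every side context empty, truth alone meets the premises of (Inf) and nothing is added
    -- to `Δ`.
    subst (λ Θ → ⊩[ Preserving ] map atom Θ ++ Δ) (concat-empties (length Γ))
      (s Preserving id (λ _ → []) λ i →
        adjoin-true (lookup Γ i) (All.lookup ts (∈-lookup i)) (λ _ → id) id)
    where
      concat-empties : ∀ n → concat (tabulate {n = n} λ _ → [] {A = At}) ≡ []
      concat-empties zero    = refl
      concat-empties (suc n) = concat-empties n

  ⊩⇒¬Refutes : ∀ {Γ Δ} → Γ ⊩ Δ → ¬ Refutes v (Γ ⇒ Δ)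
  ⊩⇒¬Refutes {Γ} Γ⊩Δ (ts , fs) =
    ⊢-sound (false-toAtomic fs id (true-discharge Γ ts (Γ⊩Δ Preserving ST⊑Preserving))) [] []

theorem3 : (At : Set) → At ↔ ℕ → (Γ Δ : List (Formula At)) → Γ ⊩ Δ → CLp⊢ Γ ⇒ Δ
-- Countability supplies the decidable equality of atoms on which the search at atomic sequents
-- relies.
theorem3 At At↔ℕ Γ Δ Γ⊩Δ with decide (via-injection (↔⇒↣ At↔ℕ) _≟ℕ_) Γ Δ
... | inj₁ d       = d
... | inj₂ (v , r) = contradiction r (⊩⇒¬Refutes v Γ⊩Δ)
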